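{- Let $\mathcal{I}$ be an inference system on a universe $\mathcal{U}$ and let $\gamma,\beta\in\wp(\mathcal{U})$. Then the following facts hold: (1) $(F_{\mathcal{I}})_{\sqcup\gamma}=F_{(\mathcal{I}_{\sqcup\gamma})}$; (2) $(F_{\mathcal{I}})_{\sqcap\beta}=F_{(\mathcal{I}_{\sqcap\beta})}$; (3) $\nabla_{F_{\mathcal{I}}}(\gamma)=\mathit{Ind}(\mathcal{I}_{\sqcup\gamma})$; (4) $\Delta_{F_{\mathcal{I}}}(\beta)=\mathit{CoInd}(\mathcal{I}_{\sqcap\beta})$.
   Context: Fix a set $\mathcal{U}$ (the universe), whose elements are called judgements. An inference system $\mathcal{I}$ is a set of rules, i.e. pairs $\frac{Pr}{c}$ with $Pr\subseteq\mathcal{U}$ (premises, an arbitrary set) and $c\in\mathcal{U}$ (conclusion). Its inference operator is the monotone function $F_{\mathcal{I}}:\wp(\mathcal{U})\to\wp(\mathcal{U})$, $F_{\mathcal{I}}(S)=\{c \mid \exists \frac{Pr}{c}\in\mathcal{I},\ Pr\subseteq S\}$. $\mathit{Ind}(\mathcal{I})$ (inductive interpretation) and $\mathit{CoInd}(\mathcal{I})$ (coinductive interpretation) are the least and the greatest fixed point of $F_{\mathcal{I}}$. For $\gamma\subseteq\mathcal{U}$, $\mathcal{I}_{\sqcup\gamma}=\mathcal{I}\cup\{\frac{\emptyset}{c}\mid c\in\gamma\}$; for $\beta\subseteq\mathcal{U}$, $\mathcal{I}_{\sqcap \beta}=\{\frac{Pr}{c}\in\mathcal{I}\mid c\in \beta\}$.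 For a complete lattice $(L,\sqsubseteq)$ and a monotone $F:L\to L$, and $\gamma,\beta\in L$: $F_{\sqcup\gamma}(x)=F(x)\sqcup\gamma$ and $F_{\sqcap\beta}(x)=F(x)\sqcap\beta$; the closure of $F$ is $\nabla_F(x)=\inf\{y\in L\mid F(y)\sqsubseteq y,\ x\sqsubseteq y\}$ and the kernel of $F$ is $\Delta_F(x)=\bigsqcup\{y\in L\mid y\sqsubseteq F(y),\ y\sqsubseteq x\}$. Here these are applied with $L=\wp(\mathcal{U})$ ordered by inclusion and $F=F_{\mathcal{I}}$. -}

module Defs where

open import Level using (Level; suc)
open import Data.Product.Base using (Σ; ∃-syntax; _×_; _,_; proj₁; proj₂)
open import Relation.Unary using (Pred; _∈_; _⊆_; _≐_; _∪_; _∩_; ∅; ⋃; ⋂)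
open import Relation.Unary.PredicateTransformer using (Pt)

private
  variable
    a b ℓ : Level
    𝓤 : Set ℓ

-- Agda is predicative, so a set of rules is one universe level above the
-- premises of its rules.  Premises are subsets at the level ℓ of the universe
-- of judgements, and the powerset on which inference operators act (the one
-- that γ, β and the interpretations belong to) is taken at level suc ℓ; it
-- contains all premise sets up to level lifting, and inference operators are
-- endofunctions on it.

℘ : Set ℓ → Set (suc (suc ℓ))
℘ {ℓ} 𝓤 = Pred 𝓤 (suc ℓ)

Rule : Set ℓ → Set (suc ℓ)
Rule {ℓ} 𝓤 = Pred 𝓤 ℓ × 𝓤

InferenceSystem : Set ℓ → Set (suc (suc ℓ))
InferenceSystem {ℓ} 𝓤 = Pred (Rule 𝓤) (suc ℓ)

module _ {𝓤 : Set ℓ} where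

  -- The level of S is arbitrary so that F can also be applied to premise sets.
  F : InferenceSystem 𝓤 → Pred 𝓤 a → Pred 𝓤 _
  F I S c = ∃[ Pr ] (Pr , c) ∈ I × Pr ⊆ S

  F-mono : (I : InferenceSystem 𝓤) {S : Pred 𝓤 a} {T : Pred 𝓤 b} →
           S ⊆ T → F I S ⊆ F I T
  F-mono I S⊆T (Pr , r∈I , Pr⊆S) = Pr , r∈I , λ x∈Pr → S⊆T (Pr⊆S x∈Pr)

  infixl 6 _⊔ᴵ_ _⊓ᴵ_ _⊔ᶠ_ _⊓ᶠ_

  -- The rules ∅/c with c ∈ γ; subsets are compared extensionally, as everywhere.
  axioms : ℘ 𝓤 → InferenceSystem 𝓤
  axioms γ (Pr , c) = Pr ≐ ∅ × c ∈ γ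

  _⊔ᴵ_ : InferenceSystem 𝓤 → ℘ 𝓤 → InferenceSystem 𝓤
  I ⊔ᴵ γ = I ∪ axioms γ

  _⊓ᴵ_ : InferenceSystem 𝓤 → ℘ 𝓤 → InferenceSystem 𝓤
  I ⊓ᴵ β = I ∩ (λ (Pr , c) → c ∈ β)

  _⊔ᶠ_ : Pt 𝓤 (suc ℓ) → ℘ 𝓤 → Pt 𝓤 (suc ℓ)
  (G ⊔ᶠ γ) S = G S ∪ γ

  _⊓ᶠ_ : Pt 𝓤 (suc ℓ) → ℘ 𝓤 → Pt 𝓤 (suc ℓ)
  (G ⊓ᶠ β) S = G S ∩ β

  -- Infima and suprema in the powerset are intersections and unions.  These
  -- range over a family of subsets that is not small, so as types they live
  -- one level above ℘ 𝓤; _≐_ compares subsets at different levels.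

  ∇ : Pt 𝓤 (suc ℓ) → ℘ 𝓤 → Pred 𝓤 _
  ∇ G x = ⋂ (Σ (℘ 𝓤) λ y → G y ⊆ y × x ⊆ y) proj₁

  Δ : Pt 𝓤 (suc ℓ) → ℘ 𝓤 → Pred 𝓤 _
  Δ G x = ⋃ (Σ (℘ 𝓤) λ y → y ⊆ G y × y ⊆ x) proj₁

  record LeastFixedPoint (G : Pt 𝓤 (suc ℓ)) : Set (suc (suc ℓ)) where
    field
      μ     : ℘ 𝓤
      fixed : G μ ≐ μ
      least : ∀ {S} → G S ≐ S → μ ⊆ S

  record GreatestFixedPoint (G : Pt 𝓤 (suc ℓ)) : Set (suc (suc ℓ)) where
    field
      ν        : ℘ 𝓤
      fixed    : G ν ≐ ν
      greatest : ∀ {S} → G S ≐ S → S ⊆ ν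

  data Derivable (I : InferenceSystem 𝓤) : ℘ 𝓤 where
    infer : F I (Derivable I) ⊆ Derivable I

  derivable-rec : (I : InferenceSystem 𝓤) {S : ℘ 𝓤} → F I S ⊆ S → Derivable I ⊆ S
  derivable-rec I FS⊆S (infer (Pr , r∈I , ds)) =
    FS⊆S (Pr , r∈I , λ x∈Pr → derivable-rec I FS⊆S (ds x∈Pr))

  lfp : (I : InferenceSystem 𝓤) → LeastFixedPoint (F I)
  lfp I = record
    { μ     = Derivable I
    ; fixed = infer , λ { (infer d) → d }
    ; least = λ (FS⊆S , _) → derivable-rec I FS⊆S
    }

  -- The union of the post-fixed points at the level of premises only, which
  -- keeps it inside ℘ 𝓤.  It contains every post-fixed point S in ℘ 𝓤: choosing
  -- a rule for each element of S, the judgements reachable from a given one by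
  -- passing to premises form a post-fixed point at the lower level.

  Coderivable : InferenceSystem 𝓤 → ℘ 𝓤
  Coderivable I = ⋃ (Σ (Pred 𝓤 ℓ) λ S → S ⊆ F I S) proj₁

  module _ (I : InferenceSystem 𝓤) {S : ℘ 𝓤} (S⊆FS : S ⊆ F I S) where

    data Reachable {c : 𝓤} (s : c ∈ S) : Pred 𝓤 ℓ where
      here  : c ∈ Reachable s
      there : ∀ {x y} (x∈Pr : x ∈ proj₁ (S⊆FS s)) →
              y ∈ Reachable (proj₂ (proj₂ (S⊆FS s)) x∈Pr) → y ∈ Reachable s

    reachable-post : ∀ {c} (s : c ∈ S) → Reachable s ⊆ F I (Reachable s)
    reachable-post s here =
      proj₁ (S⊆FS s) , proj₁ (proj₂ (S⊆FS s)) , λ x∈Pr → there x∈Pr here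
    reachable-post s (there x∈Pr r) = F-mono I (there x∈Pr) (reachable-post _ r)

    coderivable-corec : S ⊆ Coderivable I
    coderivable-corec s = (Reachable s , reachable-post s) , here

  coderivable-post : (I : InferenceSystem 𝓤) → Coderivable I ⊆ F I (Coderivable I)
  coderivable-post I (Z@(_ , S⊆FS) , s) = F-mono I (λ t → Z , t) (S⊆FS s)

  gfp : (I : InferenceSystem 𝓤) → GreatestFixedPoint (F I)
  gfp I = record
    { ν        = Coderivable I
    ; fixed    = coderivable-corec I (F-mono I (coderivable-post I)) , coderivable-post I
    ; greatest = λ (_ , S⊆FS) → coderivable-corec I S⊆FS
    }

  Ind : InferenceSystem 𝓤 → ℘ 𝓤
  Ind I = LeastFixedPoint.μ (lfp I)

  CoInd : InferenceSystem 𝓤 → ℘ 𝓤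
  CoInd I = GreatestFixedPoint.ν (gfp I)

{-# OPTIONS --safe #-}
module Submission where

open import Data.Empty.Polymorphic using (⊥)
open import Data.Product.Base using (_×_; _,_; proj₁; proj₂)
open import Data.Sum.Base using (inj₁; inj₂; [_,_])
open import Function.Base using (_∘_)
open import Level using (Level)
open import Relation.Unary using (_≐_; _⊆_)
open import Defs

-- The pre-fixed points of F (I ⊔ᴵ γ) are those of F I that contain γ, and the
-- post-fixed points of F (I ⊓ᴵ β) are those of F I that are contained in β; so
-- (3) and (4) follow from (1) and (2) by induction and coinduction.

private
  variable
    ℓ : Level
    𝓤 : Set ℓ

F-⊔ : (I : InferenceSystem 𝓤) (γ S : ℘ 𝓤) → (F I ⊔ᶠ γ) S ≐ F (I ⊔ᴵ γ) S
F-⊔ I γ S = to , from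
  where
  to : (F I ⊔ᶠ γ) S ⊆ F (I ⊔ᴵ γ) S
  to (inj₁ (Pr , r∈I , Pr⊆S)) = Pr , inj₁ r∈I , Pr⊆S
  -- Premise sets live at level `ℓ` and `∅` at level zero, hence the level-polymorphic `⊥` here; the
  -- two agree only up to `≐`.
  to (inj₂ c∈γ)               = (λ _ → ⊥) , inj₂ (((λ ()) , λ ()) , c∈γ) , λ ()

  from : F (I ⊔ᴵ γ) S ⊆ (F I ⊔ᶠ γ) S
  from (Pr , inj₁ r∈I , Pr⊆S)    = inj₁ (Pr , r∈I , Pr⊆S)
  from (_ , inj₂ (_ , c∈γ) , _) = inj₂ c∈γ

F-⊓ : (I : InferenceSystem 𝓤) (β S : ℘ 𝓤) → (F I ⊓ᶠ β) S ≐ F (I ⊓ᴵ β) S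
F-⊓ I β S =
  (λ ((Pr , r∈I , Pr⊆S) , c∈β) → Pr , (r∈I , c∈β) , Pr⊆S) ,
  (λ (Pr , (r∈I , c∈β) , Pr⊆S) → (Pr , r∈I , Pr⊆S) , c∈β)

∇-Ind : (I : InferenceSystem 𝓤) (γ : ℘ 𝓤) → ∇ (F I) γ ≐ Ind (I ⊔ᴵ γ)
∇-Ind I γ =
  -- `D` belongs to the family being intersected; each summand of `F-⊔` yields one of the two
  -- membership conditions.
  (λ c∈∇ → c∈∇ (D , (λ p → infer (proj₁ (F-⊔ I γ D) (inj₁ p)))
                  , (λ p → infer (proj₁ (F-⊔ I γ D) (inj₂ p))))) ,
  (λ d (y , Fy⊆y , γ⊆y) →
    derivable-rec (I ⊔ᴵ γ) (λ p → [ Fy⊆y , γ⊆y ] (proj₂ (F-⊔ I γ y) p)) d)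
  where D = Derivable (I ⊔ᴵ γ)

Δ-CoInd : (I : InferenceSystem 𝓤) (β : ℘ 𝓤) → Δ (F I) β ≐ CoInd (I ⊓ᴵ β)
Δ-CoInd I β =
  (λ ((y , y⊆Fy , y⊆β) , c∈y) →
    -- `y` lives one level above the subsets united in `Coderivable`; `coderivable-corec` bridges
    -- this gap.
    coderivable-corec (I ⊓ᴵ β) (λ s → proj₁ (F-⊓ I β y) (y⊆Fy s , y⊆β s)) c∈y) ,
  -- `C` is in `℘ 𝓤`, so it can itself be a member of the family whose union is `Δ`.
  (λ c∈C → (C , proj₁ ∘ post , proj₂ ∘ post) , c∈C)
  where
  C = Coderivable (I ⊓ᴵ β)

  post : C ⊆ (F I ⊓ᶠ β) C
  post s = proj₂ (F-⊓ I β C) (coderivable-post (I ⊓ᴵ β) s)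

theorem3p14 : ∀ {ℓ} {𝓤 : Set ℓ} (I : InferenceSystem 𝓤) (γ β : ℘ 𝓤) →
    (∀ (S : ℘ 𝓤) → (F I ⊔ᶠ γ) S ≐ F (I ⊔ᴵ γ) S) ×
    (∀ (S : ℘ 𝓤) → (F I ⊓ᶠ β) S ≐ F (I ⊓ᴵ β) S) ×
    (∇ (F I) γ ≐ Ind (I ⊔ᴵ γ)) ×
    (Δ (F I) β ≐ CoInd (I ⊓ᴵ β))
theorem3p14 I γ β = F-⊔ I γ , F-⊓ I β , ∇-Ind I γ , Δ-CoInd I β
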